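{- Let $d\ge 1$ and let $H$ be a $d$-regular graph that has BEL gadgets. Suppose there exists a vertex $v\in V(H)$ such that $N(v)$ is an independent set and $H-v-N(v)$ (the graph obtained from $H$ by deleting $v$ and all its neighbors) is connected. Then $s(H)=2d-1$.
   Context: All graphs are finite and simple; a copy of a graph means a (not necessarily induced) subgraph isomorphic to it. For graphs $F,H$, write $F\to H$ if every 2-coloring (red/blue) of the edges of $F$ contains a monochromatic copy of $H$, and $F\not\to H$ otherwise. $F$ is Ramsey $H$-minimal if $F\to H$ and no proper subgraph $F'$ of $F$ satisfies $F'\to H$; $\mathcal{M}(H)$ denotes the set of such graphs, and $s(H)=\min_{F\in\mathcal{M}(H)}\delta(F)$ with $\delta(F)$ the minimum degree. A graph $H$ has BEL gadgets if for every graph $G$ and every 2-coloring $\psi$ of the edges of $G$ without a monochromatic copy of $H$, there is a graph $F$ such that (1) $F\not\to H$, (2) $F$ contains $G$ as an induced subgraph, and (3) for every 2-coloring of the edges of $F$ without a monochromatic copy of $H$, its restriction to $G$ agrees with $\psi$ up to swapping the two colors. -}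

module Defs where

open import Data.Nat using (ℕ; _≤_; _+_)
open import Data.Fin using (Fin)
open import Data.Bool using (Bool; true; false; not; if_then_else_; _∧_)
open import Data.List using (List; allFin)
import Data.List as L
open import Data.Nat.ListAction using (sum)
open import Data.Product using (Σ; ∃; ∃-syntax; _×_; _,_)
open import Data.Sum using (_⊎_)
open import Relation.Binary.PropositionalEquality using (_≡_; _≢_)
open import Relation.Nullary using (¬_)
open import Function.Definitions using (Injective)

record Graph : Set where
  field
    n      : ℕ
    adj    : Fin n → Fin n → Bool
    sym    : ∀ u v → adj u v ≡ adj v u
    irrefl : ∀ v → adj v v ≡ false
open Graph public

Edge : (G : Graph) → Fin (n G) → Fin (n G) → Set
Edge G u v = adj G u v ≡ true

deg : (G : Graph) → Fin (n G) → ℕ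
deg G v = sum (L.map (λ u → if adj G v u then 1 else 0) (allFin (n G)))

Regular : ℕ → Graph → Set
Regular d G = ∀ v → deg G v ≡ d

MinDeg : Graph → ℕ → Set
MinDeg G k = (∀ v → k ≤ deg G v) × (∃[ v ] deg G v ≡ k)

record Embedding (H F : Graph) : Set where
  field
    emb    : Fin (n H) → Fin (n F)
    inj    : Injective _≡_ _≡_ emb
    edges  : ∀ u v → Edge H u v → Edge F (emb u) (emb v)
open Embedding public

record InducedEmbedding (G F : Graph) : Set where
  field
    imap   : Fin (n G) → Fin (n F)
    iinj   : Injective _≡_ _≡_ imap
    iadj   : ∀ u v → adj F (imap u) (imap v) ≡ adj G u v
open InducedEmbedding public

-- 2-colouring of the edges of F (true = red, false = blue); only values on
-- edges matter, symmetry makes it a colouring of unordered edges.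
record Colouring (F : Graph) : Set where
  field
    col  : Fin (n F) → Fin (n F) → Bool
    csym : ∀ u v → col u v ≡ col v u
open Colouring public

MonoCopy : (F : Graph) → Colouring F → Graph → Set
MonoCopy F c H = Σ Bool λ b → Σ (Embedding H F) λ e →
  ∀ u v → Edge H u v → col c (emb e u) (emb e v) ≡ b

Arrows : Graph → Graph → Set
Arrows F H = (c : Colouring F) → MonoCopy F c H

Proper : {F' F : Graph} → Embedding F' F → Set
Proper {F'} {F} e =
  ¬ ((∀ x → ∃[ a ] emb e a ≡ x) ×
     (∀ x y → Edge F x y →
        ∃[ a ] ∃[ b ] (emb e a ≡ x × emb e b ≡ y × Edge F' a b)))

RamseyMinimal : Graph → Graph → Set
RamseyMinimal F H =
  Arrows F H × (∀ (F' : Graph) (e : Embedding F' F) → Proper e → ¬ Arrows F' H)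

SEq : Graph → ℕ → Set
SEq H k = (∃[ F ] (RamseyMinimal F H × MinDeg F k))
        × (∀ F → RamseyMinimal F H → ∀ v → k ≤ deg F v)

HasBEL : Graph → Set
HasBEL H =
  ∀ (G : Graph) (ψ : Colouring G) → ¬ MonoCopy G ψ H →
  Σ Graph λ F → ¬ Arrows F H × Σ (InducedEmbedding G F) λ ι →
    ∀ (φ : Colouring F) → ¬ MonoCopy F φ H →
      (∀ u v → Edge G u v → col φ (imap ι u) (imap ι v) ≡ col ψ u v)
      ⊎ (∀ u v → Edge G u v → col φ (imap ι u) (imap ι v) ≡ not (col ψ u v))

NbhdIndependent : (H : Graph) → Fin (n H) → Set
NbhdIndependent H v = ∀ u w → Edge H v u → Edge H v w → adj H u w ≡ false

Outside : (H : Graph) → Fin (n H) → Fin (n H) → Set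
Outside H v w = (w ≢ v) × (adj H v w ≡ false)

data Reach (H : Graph) (S : Fin (n H) → Set) : Fin (n H) → Fin (n H) → Set where
  here : ∀ {x} → S x → Reach H S x x
  step : ∀ {x z y} → S x → Edge H x z → Reach H S z y → Reach H S x y

ConnectedOn : (H : Graph) → (Fin (n H) → Set) → Set
ConnectedOn H S = ∀ x y → S x → S y → Reach H S x y

{-# OPTIONS --safe #-}
module Submission where

-- Lower bound: if x has degree at most 2d − 2 in F, a colouring of F − x without monochromatic copy
-- extends by using each colour at most d − 1 times at x, so F is not minimal.
--
-- Upper bound: let G consist of 2d − 1 independent anchors and, for every d-set of anchors and every
-- colour b, a copy of H − v in colour b whose neighbours of v are glued to these anchors.  Let F₀ be
-- a BEL graph for G and F the result of joining a new apex to all anchors.  Some d edges at the apex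
-- have the same colour and complete a monochromatic copy of H, so F arrows H while F₀ does not, and
-- a minimal subgraph of F has a vertex of degree 2d − 1 at the apex.
--
-- G itself has no monochromatic copy of H: all degrees of inner vertices equal d, so by connectivity
-- a copy contains the whole interior of some glued H − v, and for d ≥ 2 also its anchors, leaving a
-- single further vertex z.  An anchor has only d − 1 neighbours in that H − v, so all d anchors are
-- adjacent to z, which therefore lies inside a copy of H − v glued to the same d-set: contradiction.
-- For d = 1 there is only one d-set, and the copy would have to fit into H − v.

open import Defs
open import Axiom.UniquenessOfIdentityProofs.WithK using (uip)
open import Data.Bool using (Bool; true; false; not; if_then_else_; _∧_; _∨_)
import Data.Bool.Properties as Bool
open import Data.Empty using (⊥; ⊥-elim)
open import Data.Fin using (Fin; zero; suc; punchIn; punchOut; combine; remQuot; _↑ˡ_; _↑ʳ_; splitAt)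
open import Data.Fin.Properties
  using (_≟_; any?; all?; injective⇒≤; suc-injective; punchIn-injective; punchInᵢ≢i;
         punchIn-punchOut; punchOut-injective; remQuot-combine; combine-injective;
         ↑ˡ-injective; ↑ʳ-injective; splitAt-↑ˡ; splitAt-↑ʳ)
open import Data.List using (tabulate)
open import Data.List.Properties using (map-tabulate)
open import Data.Nat using (ℕ; zero; suc; _+_; _*_; _∸_; _≤_; _<_; z≤n; s≤s; _≤?_)
open import Data.Nat.ListAction using (sum)
import Data.Nat.Properties as ℕ
open import Data.Product using (Σ; ∃; ∃-syntax; _×_; _,_; proj₁; proj₂; uncurry)
open import Data.Sum using (_⊎_; inj₁; inj₂)
open import Data.Vec as Vec using (Vec; []; _∷_; lookup)
open import Data.Vec.Properties using (lookup∘tabulate)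
import Data.Vec.Functional as Functional
open import Function using (_∘_; id; mk⇔)
open import Function.Definitions using (Injective)
open import Relation.Binary.PropositionalEquality
  using (_≡_; _≢_; refl; cong; cong₂; subst; subst₂; trans)
  renaming (sym to ≡-sym)
open import Relation.Nullary using (¬_; Dec; yes; no; does; contradiction; ¬?)
open import Relation.Nullary.Decidable
  using (map′; _×-dec_; _→-dec_; _⊎-dec_; does-⇔; decidable-stable; dec-true; dec-false)

-- Boolean auxiliaries

∧-true : ∀ {x y} → x ∧ y ≡ true → x ≡ true × y ≡ true
∧-true {true} {true} _ = refl , refl

true≢false : ∀ {x} → x ≡ true → x ≢ false
true≢false refl ()

does-sound : {A : Set} (a? : Dec A) → does a? ≡ true → A
does-sound (yes a) _ = a

-- Cardinalities of decidable subsets of Fin N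

count : ∀ {N} → (Fin N → Bool) → ℕ
count {zero}  p = 0
count {suc N} p = (if p zero then 1 else 0) + count (p ∘ suc)

-- A bijection between `Fin k` and the subset `p`. The inverse `ix` takes a membership proof because
-- it is defined only on members.
record Enumeration {N : ℕ} (p : Fin N → Bool) (k : ℕ) : Set where
  field
    at     : Fin k → Fin N
    at-∈   : ∀ i → p (at i) ≡ true
    at-inj : Injective _≡_ _≡_ at
    ix     : ∀ x → p x ≡ true → Fin k
    at-ix  : ∀ x px → at (ix x px) ≡ x

  ix-inj : ∀ x px y py → ix x px ≡ ix y py → x ≡ y
  ix-inj x px y py eq = trans (≡-sym (at-ix x px)) (trans (cong at eq) (at-ix y py))

  ix-at : ∀ i px → ix (at i) px ≡ i
  ix-at i px = at-inj (at-ix (at i) px)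
open Enumeration

enumerate : ∀ {N} (p : Fin N → Bool) → Enumeration p (count p)
enumerate {zero} p = record
  { at = λ () ; at-∈ = λ () ; at-inj = λ { {()} } ; ix = λ () ; at-ix = λ () }
enumerate {suc N} p with p zero in eq | enumerate (p ∘ suc)
... | false | E = record
  { at     = suc ∘ at E
  ; at-∈   = at-∈ E
  ; at-inj = λ e → at-inj E (suc-injective e)
  ; ix     = λ { zero pz → contradiction eq (true≢false pz) ; (suc x) px → ix E x px }
  ; at-ix  = λ { zero pz → contradiction eq (true≢false pz) ; (suc x) px → cong suc (at-ix E x px) }
  }
... | true | E = record
  { at     = λ { zero → zero ; (suc i) → suc (at E i) }
  ; at-∈   = λ { zero → eq ; (suc i) → at-∈ E i }
  ; at-inj = λ { {zero} {zero} _ → refl ; {suc i} {suc j} e → cong suc (at-inj E (suc-injective e)) }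
  ; ix     = λ { zero _ → zero ; (suc x) px → suc (ix E x px) }
  ; at-ix  = λ { zero _ → refl ; (suc x) px → cong suc (at-ix E x px) }
  }

record _↪_ {N M : ℕ} (p : Fin N → Bool) (q : Fin M → Bool) : Set where
  field
    to     : ∀ x → p x ≡ true → Fin M
    to-∈   : ∀ x px → q (to x px) ≡ true
    to-inj : ∀ x px y py → to x px ≡ to y py → x ≡ y
open _↪_

module _ {N M : ℕ} {p : Fin N → Bool} {q : Fin M → Bool} {a b : ℕ}
         (P : Enumeration p a) (Q : Enumeration q b) (f : p ↪ q) where

  private
    g : Fin a → Fin b
    g i = ix Q (to f (at P i) (at-∈ P i)) (to-∈ f _ _)

    g-inj : Injective _≡_ _≡_ g
    g-inj e = at-inj P (to-inj f _ _ _ _ (ix-inj Q _ _ _ _ e))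

  ↪⇒≤ : a ≤ b
  ↪⇒≤ = injective⇒≤ g-inj

  -- Sending one extra element to the missed `y` extends the injection to `Fin (suc a)`.
  ↪-missing⇒< : ∀ y → q y ≡ true → (∀ x px → to f x px ≢ y) → a < b
  ↪-missing⇒< y qy miss = injective⇒≤ {f = h} h-inj
    where
    h : Fin (suc a) → Fin b
    h zero    = ix Q y qy
    h (suc i) = g i

    h-inj : Injective _≡_ _≡_ h
    h-inj {zero}  {zero}  _ = refl
    h-inj {zero}  {suc j} e = ⊥-elim (miss _ _ (≡-sym (ix-inj Q _ _ _ _ e)))
    h-inj {suc i} {zero}  e = ⊥-elim (miss _ _ (ix-inj Q _ _ _ _ e))
    h-inj {suc i} {suc j} e = cong suc (g-inj e)

↪-onto : ∀ {N M k} {p : Fin N → Bool} {q : Fin M → Bool} →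
         Enumeration p k → Enumeration q k → (f : p ↪ q) →
         ∀ y → q y ≡ true → ∃[ x ] Σ (p x ≡ true) λ px → to f x px ≡ y
↪-onto P Q f y qy with any? (λ i → to f (at P i) (at-∈ P i) ≟ y)
... | yes (i , eq) = at P i , at-∈ P i , eq
... | no none = ⊥-elim (ℕ.<-irrefl refl (↪-missing⇒< P Q f y qy miss))
  where
  miss : ∀ x px → to f x px ≢ y
  miss x px eq = none (ix P x px , trans (subst-to (at-ix P x px)) eq)
    where
    -- The value of `to f` may depend on the membership proof; uniqueness of identity proofs removes
    -- this dependence.
    subst-to : ∀ {x′ px′} → x′ ≡ x → to f x′ px′ ≡ to f x px
    subst-to refl = cong (to f x) (uip _ _)

injective-missing : ∀ {N} (f : Fin N → Fin N) → Injective _≡_ _≡_ f → ∀ y → ¬ (∀ x → f x ≢ y)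
injective-missing {suc N} f f-inj y miss =
  ℕ.<-irrefl refl (injective⇒≤ {f = λ x → punchOut (off x)}
    (λ e → f-inj (punchOut-injective (off _) (off _) e)))
  where
  off : ∀ x → y ≢ f x
  off x e = miss x (≡-sym e)

count-all : ∀ N → count {N} (λ _ → true) ≡ N
count-all zero    = refl
count-all (suc N) = cong suc (count-all N)

count-complement : ∀ {N} (p : Fin N → Bool) → count p + count (not ∘ p) ≡ N
count-complement {zero} p = refl
count-complement {suc N} p with p zero
... | true  = cong suc (count-complement (p ∘ suc))
... | false = trans (ℕ.+-suc _ _) (cong suc (count-complement (p ∘ suc)))

-- Balanced splittings and degrees

is : Bool → Bool → Bool
is true  x = x
is false x = not x

is-sound : ∀ β {x} → is β x ≡ true → x ≡ β
is-sound true  e = e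
is-sound false {false} e = refl

is-complete : ∀ β → is β β ≡ true
is-complete true  = refl
is-complete false = refl

-- Greedy: members are coloured `true` until the budget `r` is spent, and `false` afterwards.
split : ∀ {N} (p : Fin N → Bool) r b → count p ≤ r + b →
        Σ (Fin N → Bool) λ χ → (count (λ x → p x ∧ χ x) ≤ r × count (λ x → p x ∧ not (χ x)) ≤ b)
split {zero} p r b le = (λ ()) , z≤n , z≤n
split {suc N} p r b le with p zero
split {suc N} p r b le | false with χ , h₁ , h₂ ← split (p ∘ suc) r b le =
  -- The colour of a non-member is arbitrary.
  true Functional.∷ χ , h₁ , h₂
split {suc N} p (suc r) b (s≤s le) | true with χ , h₁ , h₂ ← split (p ∘ suc) r b le =
  true Functional.∷ χ , s≤s h₁ , h₂
split {suc N} p zero (suc b) (s≤s le) | true with χ , h₁ , h₂ ← split (p ∘ suc) zero b le =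
  false Functional.∷ χ , h₁ , s≤s h₂

balanced : ∀ {N} (p : Fin N → Bool) a → count p ≤ a + a →
           Σ (Fin N → Bool) λ χ → (∀ β → count (λ x → p x ∧ is β (χ x)) ≤ a)
balanced p a le with χ , r , b ← split p a a le = χ , λ { true → r ; false → b }

deg≡count : ∀ G v → deg G v ≡ count (adj G v)
deg≡count G v =
  trans (cong sum (map-tabulate id (λ u → if adj G v u then 1 else 0))) (sum-tabulate (adj G v))
  where
  sum-tabulate : ∀ {N} (p : Fin N → Bool) →
                 sum (tabulate (λ u → if p u then 1 else 0)) ≡ count p
  sum-tabulate {zero}  p = refl
  sum-tabulate {suc N} p = cong ((if p zero then 1 else 0) +_) (sum-tabulate (p ∘ suc))

neighbours : ∀ G v → Enumeration (adj G v) (deg G v)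
neighbours G v = subst (Enumeration _) (≡-sym (deg≡count G v)) (enumerate _)

-- Decidability of the arrow relation

-- Exhaustive search. Extracting a minimal subgraph requires deciding the arrow relation, so
-- embeddings and colourings are searched as vectors of their values.
Searchable : Set → Set₁
Searchable A = {P : A → Set} → (∀ x → Dec (P x)) → Dec (∃ P)

search-Bool : Searchable Bool
search-Bool P? with P? true | P? false
... | yes p | _     = yes (true , p)
... | no _  | yes p = yes (false , p)
... | no ¬t | no ¬f = no λ { (true , p) → ¬t p ; (false , p) → ¬f p }

search-Vec : ∀ {A} → Searchable A → ∀ k → Searchable (Vec A k)
search-Vec s zero    P? = map′ (λ p → [] , p) (λ { ([] , p) → p }) (P? [])
search-Vec s (suc k) P? =
  map′ (λ { (x , xs , p) → x ∷ xs , p }) (λ { (x ∷ xs , p) → x , xs , p })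
       (s λ x → search-Vec s k λ xs → P? (x ∷ xs))

edge? : ∀ G u v → Dec (Edge G u v)
edge? G u v = adj G u v Bool.≟ true

monoCopy? : ∀ F c H → Dec (MonoCopy F c H)
monoCopy? F c H =
  map′ decode encode
    (search-Bool λ b → search-Vec (λ P? → any? P?) (n H) λ f →
      (all? λ u → all? λ v → (lookup f u ≟ lookup f v) →-dec (u ≟ v)) ×-dec
      (all? λ u → all? λ v → edge? H u v →-dec edge? F (lookup f u) (lookup f v)) ×-dec
      (all? λ u → all? λ v → edge? H u v →-dec (col c (lookup f u) (lookup f v) Bool.≟ b)))
  where
  IsCopy : Bool → (Fin (n H) → Fin (n F)) → Set
  IsCopy b f = (∀ u v → f u ≡ f v → u ≡ v) × (∀ u v → Edge H u v → Edge F (f u) (f v))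
             × (∀ u v → Edge H u v → col c (f u) (f v) ≡ b)

  decode : (∃[ b ] ∃[ f ] IsCopy b (lookup f)) → MonoCopy F c H
  decode (b , f , i , e , m) = b , record { emb = lookup f ; inj = i _ _ ; edges = e } , m

  encode : MonoCopy F c H → ∃[ b ] ∃[ f ] IsCopy b (lookup f)
  encode (b , e , m) = b , Vec.tabulate (emb e)
    , (λ u v q → inj e (trans (≡-sym (at′ u)) (trans q (at′ v))))
    , (λ u v q → trans (cong₂ (adj F) (at′ u) (at′ v)) (edges e u v q))
    , (λ u v q → trans (cong₂ (col c) (at′ u) (at′ v)) (m u v q))
    where at′ = lookup∘tabulate (emb e)

arrows? : ∀ F H → Dec (Arrows F H)
arrows? F H =
  map′ arrows (λ { arr (M , none) → none (arr (decode M)) })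
    (¬? (search-Vec (search-Vec search-Bool (n F)) (n F) λ M → ¬? (monoCopy? F (decode M) H)))
  where
  -- An arbitrary matrix need not be symmetric. Conjunction with its transpose makes it so and
  -- leaves symmetric matrices unchanged.
  decode : Vec (Vec Bool (n F)) (n F) → Colouring F
  decode M = record
    { col  = λ u v → lookup (lookup M u) v ∧ lookup (lookup M v) u
    ; csym = λ u v → Bool.∧-comm (lookup (lookup M u) v) _
    }

  module _ (c : Colouring F) where
    M = Vec.tabulate λ u → Vec.tabulate (col c u)

    entry : ∀ u v → lookup (lookup M u) v ≡ col c u v
    entry u v = trans (cong (λ r → lookup r v) (lookup∘tabulate _ u)) (lookup∘tabulate (col c u) v)

    agree : ∀ u v → col (decode M) u v ≡ col c u v
    agree u v = trans (cong₂ _∧_ (entry u v) (trans (entry v u) (csym c v u))) (Bool.∧-idem _)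

  arrows : ¬ (∃[ M ] ¬ MonoCopy F (decode M) H) → Arrows F H
  arrows none c
    with b , e , m ← decidable-stable (monoCopy? F (decode (M c)) H) (λ ¬m → none (M c , ¬m))
    = b , e , λ u v q → trans (≡-sym (agree c _ _)) (m u v q)

-- Subgraphs

_∘ᵉ_ : ∀ {F G H} → Embedding G F → Embedding H G → Embedding H F
f ∘ᵉ g = record
  { emb   = emb f ∘ emb g
  ; inj   = inj g ∘ inj f
  ; edges = λ u v → edges f _ _ ∘ edges g u v
  }

idᵉ : ∀ {F} → Embedding F F
idᵉ = record { emb = id ; inj = id ; edges = λ _ _ → id }

pullback : ∀ {F′ F} → Embedding F′ F → Colouring F → Colouring F′
pullback e c = record { col = λ u v → col c (emb e u) (emb e v) ; csym = λ u v → csym c _ _ }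

push : ∀ {F′ F H} (e : Embedding F′ F) c → MonoCopy F′ (pullback e c) H → MonoCopy F c H
push e c (b , k , m) = b , e ∘ᵉ k , m

arrows-mono : ∀ {F′ F H} → Embedding F′ F → Arrows F′ H → Arrows F H
arrows-mono e arr c = push e c (arr (pullback e c))

deg-mono : ∀ {F′ F} (e : Embedding F′ F) a → deg F′ a ≤ deg F (emb e a)
deg-mono {F′} {F} e a = ↪⇒≤ (neighbours F′ a) (neighbours F (emb e a)) record
  { to = λ u _ → emb e u ; to-∈ = λ u → edges e a u ; to-inj = λ _ _ _ _ → inj e }

induced⇒embedding : ∀ {G F} → InducedEmbedding G F → Embedding G F
induced⇒embedding ι = record
  { emb = imap ι ; inj = iinj ι ; edges = λ u v e → trans (iadj ι u v) e }

-- Describes `F − x` up to isomorphism, so that it covers both removing a vertex from a given graph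
-- and removing an apex added to one.
record Deletion (F : Graph) (x : Fin (n F)) (F′ : Graph) : Set where
  field
    ι      : InducedEmbedding F′ F
    avoids : ∀ a → imap ι a ≢ x
    covers : ∀ y → y ≢ x → ∃[ a ] imap ι a ≡ y

  inclusion : Embedding F′ F
  inclusion = induced⇒embedding ι

  proper : Proper inclusion
  proper (onto , _) with a , eq ← onto x = avoids a eq

  restrict : ∀ {H} (e : Embedding H F) → (∀ h → emb e h ≢ x) →
             Σ (Embedding H F′) λ e′ → ∀ h → imap ι (emb e′ h) ≡ emb e h
  restrict {H} e miss = record
    { emb   = λ h → proj₁ (pre h)
    ; inj   = λ {h} {k} eq → inj e (trans (≡-sym (proj₂ (pre h)))
                                   (trans (cong (imap ι) eq) (proj₂ (pre k))))
    ; edges = λ u v q → trans (≡-sym (iadj ι _ _))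
                       (trans (cong₂ (adj F) (proj₂ (pre u)) (proj₂ (pre v))) (edges e u v q))
    } , λ h → proj₂ (pre h)
    where
    pre : ∀ h → ∃[ a ] imap ι a ≡ emb e h
    pre h = covers (emb e h) (miss h)
open Deletion

deleteVertex : ∀ F x → Σ Graph λ F′ → Deletion F x F′ × suc (n F′) ≡ n F
deleteVertex record { n = suc N ; adj = A ; sym = s ; irrefl = r } x = record
  { n      = N
  ; adj    = λ u v → A (punchIn x u) (punchIn x v)
  ; sym    = λ u v → s _ _
  ; irrefl = λ v → r _
  } , record
  { ι      = record { imap = punchIn x ; iinj = punchIn-injective x _ _ ; iadj = λ _ _ → refl }
  ; avoids = punchInᵢ≢i x
  ; covers = λ y y≢x → punchOut (y≢x ∘ ≡-sym) , punchIn-punchOut _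
  } , refl

-- Edge deletion and minimal arrowing subgraphs

pair : ∀ {N} (x y u v : Fin N) → Bool
pair x y u v = (does (u ≟ x) ∧ does (v ≟ y)) ∨ (does (v ≟ x) ∧ does (u ≟ y))

pair-sound : ∀ {N} (x y u v : Fin N) → pair x y u v ≡ true → (u ≡ x × v ≡ y) ⊎ (v ≡ x × u ≡ y)
pair-sound x y u v e with u ≟ x | v ≟ y
... | yes p | yes q = inj₁ (p , q)
... | yes p | no _ with yes q ← v ≟ x | yes r ← u ≟ y = inj₂ (q , r)
pair-sound x y u v e | no _ | _ with yes q ← v ≟ x | yes r ← u ≟ y = inj₂ (q , r)

pair-refl : ∀ {N} (x y : Fin N) → pair x y x y ≡ true
pair-refl x y rewrite dec-true (x ≟ x) refl | dec-true (y ≟ y) refl = refl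

deleteEdge : ∀ F (x y : Fin (n F)) → Graph
deleteEdge F x y = record
  { n      = n F
  ; adj    = λ u v → adj F u v ∧ not (pair x y u v)
  ; sym    = λ u v → cong₂ _∧_ (sym F u v) (cong not (Bool.∨-comm (does (u ≟ x) ∧ _) _))
  ; irrefl = λ v → cong (_∧ _) (irrefl F v)
  }

deleteEdge-inclusion : ∀ F x y → Embedding (deleteEdge F x y) F
deleteEdge-inclusion F x y = record
  { emb = id ; inj = id ; edges = λ u v e → proj₁ (∧-true e) }

edgeSet : ∀ F → Fin (n F * n F) → Bool
edgeSet F i = uncurry (adj F) (remQuot (n F) i)

-- Counts ordered pairs, hence twice the number of edges; it serves as a termination measure.
edgeCount : Graph → ℕ
edgeCount F = count (edgeSet F)

edgeSet-combine : ∀ F u v → edgeSet F (combine u v) ≡ adj F u v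
edgeSet-combine F u v = cong (uncurry (adj F)) (remQuot-combine u v)

deleteEdge-edgeCount : ∀ F x y → Edge F x y → edgeCount (deleteEdge F x y) < edgeCount F
deleteEdge-edgeCount F x y e =
  ↪-missing⇒< (enumerate _) (enumerate _)
    record { to = λ i _ → i ; to-∈ = λ i p → proj₁ (∧-true p) ; to-inj = λ _ _ _ _ → id }
    (combine x y) (trans (edgeSet-combine F x y) e)
    (λ { i p refl → true≢false (trans (≡-sym (edgeSet-combine (deleteEdge F x y) x y)) p) gone })
  where
  gone : adj F x y ∧ not (pair x y x y) ≡ false
  gone rewrite pair-refl x y = Bool.∧-zeroʳ _

-- A proper subgraph misses a vertex or an edge, hence embeds into a single deletion, which would
-- arrow `H` as well.
critical⇒minimal : ∀ F H → Arrows F H →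
  (∀ x → ¬ Arrows (proj₁ (deleteVertex F x)) H) →
  (∀ x y → Edge F x y → ¬ Arrows (deleteEdge F x y) H) →
  RamseyMinimal F H
critical⇒minimal F H arr noVertex noEdge =
  arr , λ F′ e prop arr′ → prop (surj F′ e arr′ , full F′ e arr′)
  where
  module _ F′ (e : Embedding F′ F) (arr′ : Arrows F′ H) where
    surj : ∀ x → ∃[ a ] emb e a ≡ x
    surj x with any? (λ a → emb e a ≟ x)
    ... | yes found = found
    ... | no none = ⊥-elim (noVertex x (arrows-mono (proj₁ (restrict D e λ h eq → none (h , eq))) arr′))
      where D = proj₁ (proj₂ (deleteVertex F x))

    full : ∀ x y → Edge F x y → ∃[ a ] ∃[ b ] (emb e a ≡ x × emb e b ≡ y × Edge F′ a b)
    full x y q with a , refl ← surj x | b , refl ← surj y with edge? F′ a b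
    ... | yes ab = a , b , refl , refl , ab
    ... | no ¬ab = ⊥-elim (noEdge _ _ q (arrows-mono e′ arr′))
      where
      kept : ∀ u v → Edge F′ u v → pair (emb e a) (emb e b) (emb e u) (emb e v) ≡ false
      kept u v uv = Bool.¬-not λ p → hit (pair-sound _ _ _ _ p)
        where
        hit : ¬ ((emb e u ≡ emb e a × emb e v ≡ emb e b) ⊎ (emb e v ≡ emb e a × emb e u ≡ emb e b))
        hit (inj₁ (p , q)) with refl ← inj e p | refl ← inj e q = ¬ab uv
        hit (inj₂ (p , q)) with refl ← inj e p | refl ← inj e q = ¬ab (trans (sym F′ _ _) uv)

      e′ : Embedding F′ (deleteEdge F (emb e a) (emb e b))
      e′ = record
        { emb = emb e ; inj = inj e
        ; edges = λ u v uv → cong₂ _∧_ (edges e u v uv) (cong not (kept u v uv)) }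

-- Vertices or edges are deleted as long as the result still arrows `H`. The recursion is
-- lexicographic: a vertex deletion lowers `N` and resets `k`, an edge deletion keeps `N` and lowers
-- the bound `k` on the edge count.
minimal-subgraph : ∀ F H → Arrows F H → ∃[ F′ ] (Embedding F′ F × RamseyMinimal F′ H)
minimal-subgraph F H = go (n F) (edgeCount F) F refl ℕ.≤-refl
  where
  go : ∀ N k F → n F ≡ N → edgeCount F ≤ k → Arrows F H →
       ∃[ F′ ] (Embedding F′ F × RamseyMinimal F′ H)
  go N k F size le arr with any? (λ x → arrows? (proj₁ (deleteVertex F x)) H)
  go zero k F size le arr | yes (x , arr′)
    with () ← trans (proj₂ (proj₂ (deleteVertex F x))) size
  go (suc N) k F size le arr | yes (x , arr′)
    with F₁ , D , eq ← deleteVertex F x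
    with F′ , e , min ← go N (edgeCount F₁) F₁ (ℕ.suc-injective (trans eq size)) ℕ.≤-refl arr′
    = F′ , inclusion D ∘ᵉ e , min
  go N k F size le arr | no noVertex
    with any? (λ x → any? λ y → edge? F x y ×-dec arrows? (deleteEdge F x y) H)
  go N zero F size le arr | no noVertex | yes (x , y , xy , arr′)
    with () ← ℕ.≤-trans (deleteEdge-edgeCount F x y xy) le
  go N (suc k) F size le arr | no noVertex | yes (x , y , xy , arr′)
    with F′ , e , min ← go N k (deleteEdge F x y) size
                          (ℕ.≤-pred (ℕ.≤-trans (deleteEdge-edgeCount F x y xy) le)) arr′
    = F′ , deleteEdge-inclusion F x y ∘ᵉ e , min
  go N k F size le arr | no noVertex | no noEdge =
    F , idᵉ , critical⇒minimal F H arr (λ x a → noVertex (x , a)) (λ x y xy a → noEdge (x , y , xy , a))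

-- The lower bound

module _ {F F′ : Graph} {x : Fin (n F)} (D : Deletion F x F′)
         (χ : Fin (n F) → Bool) (c : Colouring F′) where

  extend : Colouring F
  extend = record { col = colour ; csym = colour-sym }
    where
    colour : Fin (n F) → Fin (n F) → Bool
    colour u v with u ≟ x | v ≟ x
    -- A default value, as there is no loop at `x`.
    ... | yes _  | yes _  = true
    ... | yes _  | no _   = χ v
    ... | no _   | yes _  = χ u
    ... | no u≢x | no v≢x = col c (proj₁ (covers D u u≢x)) (proj₁ (covers D v v≢x))

    colour-sym : ∀ u v → colour u v ≡ colour v u
    colour-sym u v with u ≟ x | v ≟ x
    ... | yes _  | yes _  = refl
    ... | yes _  | no _   = refl
    ... | no _   | yes _  = refl
    ... | no u≢x | no v≢x = csym c _ _

  extend-star : ∀ v → v ≢ x → col extend x v ≡ χ v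
  extend-star v v≢x with x ≟ x | v ≟ x
  ... | _      | yes v≡x = contradiction v≡x v≢x
  ... | yes _  | no _    = refl
  ... | no x≢x | no _    = contradiction refl x≢x

  extend-inner : ∀ a b → col extend (imap (ι D) a) (imap (ι D) b) ≡ col c a b
  extend-inner a b with imap (ι D) a ≟ x | imap (ι D) b ≟ x
  ... | yes p | _     = contradiction p (avoids D a)
  ... | no _  | yes p = contradiction p (avoids D b)
  ... | no p  | no q  =
    cong₂ (col c) (iinj (ι D) (proj₂ (covers D _ p))) (iinj (ι D) (proj₂ (covers D _ q)))

minimal-degree : ∀ {d H F} → 1 ≤ d → Regular d H → RamseyMinimal F H → ∀ x → 2 * d ∸ 1 ≤ deg F x
minimal-degree {suc d} {H} {F} _ reg (arr , min) x =
  decidable-stable (_ ≤? _) λ ¬le → small (ℕ.≰⇒> ¬le)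
  where
  F′ = proj₁ (deleteVertex F x)
  D : Deletion F x F′
  D = proj₁ (proj₂ (deleteVertex F x))

  spread-arrows : ∀ χ → (∀ β → count (λ y → adj F x y ∧ is β (χ y)) ≤ d) → Arrows F′ H
  spread-arrows χ few c with arr (extend D χ c)
  ... | β , e , mono with any? (λ h → emb e h ≟ x)
  -- A copy through `x` needs `suc d` edges of colour `β` there, but `χ` provides at most `d`.
  ... | yes (h , refl) =
    ⊥-elim (ℕ.<-irrefl refl (ℕ.≤-trans
      (↪⇒≤ (subst (Enumeration _) (reg h) (neighbours H h)) (enumerate _) star) (few β)))
    where
    star : adj H h ↪ (λ y → adj F x y ∧ is β (χ y))
    star = record
      { to     = λ u _ → emb e u
      ; to-∈   = λ u hu → cong₂ _∧_ (edges e h u hu)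
          (trans (cong (is β) (trans (≡-sym (extend-star D χ c (emb e u) (off hu))) (mono h u hu)))
                 (is-complete β))
      ; to-inj = λ _ _ _ _ → inj e
      }
      where
      off : ∀ {u} → Edge H h u → emb e u ≢ emb e h
      off hu eq with refl ← inj e eq = true≢false hu (irrefl H h)
  -- A copy avoiding `x` already lies in `F′`, with the colours of `c`.
  ... | no none with e′ , lifts ← restrict D e (λ h eq → none (h , eq)) =
    β , e′ , λ u v uv → trans (≡-sym (extend-inner D χ c _ _))
      (trans (cong₂ (col (extend D χ c)) (lifts u) (lifts v)) (mono u v uv))

  bound : deg F x < 2 * suc d ∸ 1 → count (adj F x) ≤ d + d
  bound lt = ℕ.≤-pred (subst₂ _<_ (deg≡count F x) eq lt)
    where
    eq : 2 * suc d ∸ 1 ≡ suc (d + d)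
    eq = trans (ℕ.+-suc d (d + 0)) (cong (λ k → suc (d + k)) (ℕ.+-identityʳ d))

  small : ¬ (deg F x < 2 * suc d ∸ 1)
  small lt with χ , few ← balanced (adj F x) d (bound lt) =
    min F′ (inclusion D) (proper D) (spread-arrows χ few)

-- A minimal subgraph of F must use x, since F₀ does not arrow H.
minimal-degree-attained : ∀ {F F₀ H x k} → Deletion F x F₀ → Arrows F H → ¬ Arrows F₀ H →
  deg F x ≤ k → (∀ F′ → RamseyMinimal F′ H → ∀ y → k ≤ deg F′ y) →
  ∃[ F′ ] (RamseyMinimal F′ H × MinDeg F′ k)
minimal-degree-attained {F} {H = H} {x} {k} D arr fails le lower
  with F′ , e , min ← minimal-subgraph F H arr with any? (λ a → emb e a ≟ x)
... | yes (a , eq) = F′ , min , lower F′ min , a ,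
  ℕ.≤-antisym (ℕ.≤-trans (deg-mono e a) (subst (λ y → deg F y ≤ k) (≡-sym eq) le)) (lower F′ min a)
... | no none =
  ⊥-elim (fails (arrows-mono (proj₁ (restrict D e λ a eq → none (a , eq))) (proj₁ min)))

-- d-element subsets of Fin m

-- `skip` is available only while elements remain to be chosen, so every set has exactly one code
-- and equality of codes is equality of sets.
data Choice : ℕ → ℕ → Set where
  done : ∀ {m} → Choice 0 m
  take : ∀ {d m} → Choice d m → Choice (suc d) (suc m)
  skip : ∀ {d m} → Choice (suc d) m → Choice (suc d) (suc m)

pos : ∀ {d m} → Choice d m → Fin d → Fin m
pos (take c) zero    = zero
pos (take c) (suc i) = suc (pos c i)
pos (skip c) i       = suc (pos c i)

pos-inj : ∀ {d m} (c : Choice d m) → Injective _≡_ _≡_ (pos c)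
pos-inj (take c) {zero}  {zero}  _ = refl
pos-inj (take c) {suc i} {suc j} e = cong suc (pos-inj c (suc-injective e))
pos-inj (skip c) e = pos-inj c (suc-injective e)

-- Containment between sets of equal size is equality.
pos-antichain : ∀ {d m} (c c′ : Choice d m) → (∀ i → ∃[ j ] pos c′ j ≡ pos c i) → c ≡ c′
pos-antichain done done sub = refl
pos-antichain {suc d} (take c) (take c′) sub = cong take (pos-antichain c c′ tail)
  where
  tail : ∀ i → ∃[ j ] pos c′ j ≡ pos c i
  tail i with suc j , eq ← sub (suc i) = j , suc-injective eq
pos-antichain (take c) (skip c′) sub with () ← proj₂ (sub zero)
-- As `skip c` omits the first position, its `suc d` elements would have to fit among the `d` later
-- elements of `take c′`.
pos-antichain {suc d} (skip c) (take c′) sub =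
  ⊥-elim (ℕ.<-irrefl refl (injective⇒≤ {f = proj₁ ∘ tail} tail-inj))
  where
  tail : ∀ i → ∃[ j ] pos c′ j ≡ pos c i
  tail i with suc j , eq ← sub i = j , suc-injective eq

  tail-inj : Injective _≡_ _≡_ (proj₁ ∘ tail)
  tail-inj {i} {j} e =
    pos-inj c (trans (≡-sym (proj₂ (tail i))) (trans (cong (pos c′) e) (proj₂ (tail j))))
pos-antichain (skip c) (skip c′) sub =
  cong skip (pos-antichain c c′ λ i → proj₁ (sub i) , suc-injective (proj₂ (sub i)))

choose : ∀ {d m} (p : Fin m → Bool) → d ≤ count p → Σ (Choice d m) λ c → ∀ i → p (pos c i) ≡ true
choose {zero} p le = done , λ ()
choose {suc d} {suc m} p le with p zero in eq
choose {suc d} {suc m} p (s≤s le) | true with c , all ← choose (p ∘ suc) le =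
  take c , λ { zero → eq ; (suc i) → all i }
choose {suc d} {suc m} p le | false with c , all ← choose (p ∘ suc) le = skip c , all

search-Choice : ∀ d m → Searchable (Choice d m)
search-Choice zero m P? = map′ (λ p → done , p) (λ { (done , p) → p }) (P? done)
search-Choice (suc d) zero P? = no λ ()
search-Choice (suc d) (suc m) P? =
  map′ (λ { (inj₁ (c , p)) → take c , p ; (inj₂ (c , p)) → skip c , p })
       (λ { (take c , p) → inj₁ (c , p) ; (skip c , p) → inj₂ (c , p) })
       (search-Choice d m (P? ∘ take) ⊎-dec search-Choice (suc d) m (P? ∘ skip))

-- The binomial coefficient `m` over `d`, by Pascal's rule.
choices : ℕ → ℕ → ℕ
choices zero    m       = 1
choices (suc d) zero    = 0
choices (suc d) (suc m) = choices d m + choices (suc d) m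

code : ∀ {d m} → Choice d m → Fin (choices d m)
code done     = zero
code (take c) = code c ↑ˡ _
code (skip c) = _ ↑ʳ code c

↑ˡ≢↑ʳ : ∀ {a b} (i : Fin a) (j : Fin b) → i ↑ˡ b ≢ a ↑ʳ j
↑ˡ≢↑ʳ {a} {b} i j e
  with () ← trans (≡-sym (splitAt-↑ˡ a i b)) (trans (cong (splitAt a) e) (splitAt-↑ʳ a b j))

code-inj : ∀ {d m} (c c′ : Choice d m) → code c ≡ code c′ → c ≡ c′
code-inj done done _ = refl
code-inj (take c) (take c′) e = cong take (code-inj c c′ (↑ˡ-injective _ _ _ e))
code-inj (take c) (skip c′) e = ⊥-elim (↑ˡ≢↑ʳ _ _ e)
code-inj (skip c) (take c′) e = ⊥-elim (↑ˡ≢↑ʳ _ _ (≡-sym e))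
code-inj (skip c) (skip c′) e = cong skip (code-inj c c′ (↑ʳ-injective _ _ _ e))

bit : Bool → Fin 2
bit true  = zero
bit false = suc zero

bit-inj : ∀ {b b′} → bit b ≡ bit b′ → b ≡ b′
bit-inj {true}  {true}  _ = refl
bit-inj {false} {false} _ = refl

either : ∀ b → b ≡ true ⊎ b ≡ false
either true  = inj₁ refl
either false = inj₂ refl

-- The gadget graph and its colouring

module Gadget (d₀ m : ℕ) (H : Graph) (reg : Regular (suc d₀) H)
              (v : Fin (n H)) (indep : NbhdIndependent H v) where

  d = suc d₀
  h = n H

  opaque
    nbrs : ∀ x → Enumeration (adj H x) d
    nbrs x = subst (Enumeration _) (reg x) (neighbours H x)

  nbr : ∀ x → ∃[ y ] Edge H x y
  nbr x = at (nbrs x) zero , at-∈ (nbrs x) zero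

  -- The inner vertices belonging to v and its neighbours stay isolated; they only simplify the coding.
  size : ℕ
  size = m + choices d m * (2 * h)

  opaque
    anchor : Fin m → Fin size
    anchor s = s ↑ˡ _

    inner : Choice d m → Bool → Fin h → Fin size
    inner c b x = m ↑ʳ combine (code c) (combine (bit b) x)

    anchor-inj : ∀ {s s′} → anchor s ≡ anchor s′ → s ≡ s′
    anchor-inj = ↑ˡ-injective _ _ _

    anchor≢inner : ∀ {s c b x} → anchor s ≢ inner c b x
    anchor≢inner = ↑ˡ≢↑ʳ _ _

    inner-inj : ∀ {c b x c′ b′ x′} → inner c b x ≡ inner c′ b′ x′ → c ≡ c′ × b ≡ b′ × x ≡ x′
    inner-inj {c} {b} {x} {c′} {b′} {x′} e
      with e₁ , e₂ ← combine-injective (code c) (combine (bit b) x) (code c′) _ (↑ʳ-injective m _ _ e)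
      with e₃ , e₄ ← combine-injective (bit b) x (bit b′) x′ e₂
      = code-inj _ _ e₁ , bit-inj e₃ , e₄

  opaque
    -- The value at v is junk: v is replaced by the apex added later.
    placeAt : Choice d m → Bool → ∀ x {t} → adj H v x ≡ t → Fin size
    placeAt c b x {true}  vx = anchor (pos c (ix (nbrs v) x vx))
    placeAt c b x {false} _  = inner c b x

    -- Position of `x` in the glued copy with index `(c, b)`: neighbours of `v` go to the anchors
    -- chosen by `c`, other vertices to inner vertices private to that copy.
    place : Choice d m → Bool → Fin h → Fin size
    place c b x = placeAt c b x refl

    place-nbr : ∀ {c b x} (vx : Edge H v x) → place c b x ≡ anchor (pos c (ix (nbrs v) x vx))
    place-nbr {c} {b} {x} vx = go refl
      where
      go : ∀ {t} (eq : adj H v x ≡ t) → placeAt c b x eq ≡ anchor (pos c (ix (nbrs v) x vx))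
      go {true}  eq = cong (λ q → anchor (pos c (ix (nbrs v) x q))) (uip eq vx)
      go {false} eq = contradiction eq (true≢false vx)

    place-out : ∀ {c b x} → adj H v x ≡ false → place c b x ≡ inner c b x
    place-out {c} {b} {x} out = go refl
      where
      go : ∀ {t} (eq : adj H v x ≡ t) → placeAt c b x eq ≡ inner c b x
      go {true}  eq = contradiction out (true≢false eq)
      go {false} eq = refl

  place≡anchor : ∀ {c b x s} → place c b x ≡ anchor s →
                 Σ (Edge H v x) λ vx → pos c (ix (nbrs v) x vx) ≡ s
  place≡anchor {x = x} e with either (adj H v x)
  ... | inj₁ vx = vx , anchor-inj (trans (≡-sym (place-nbr vx)) e)
  ... | inj₂ out = ⊥-elim (anchor≢inner (≡-sym (trans (≡-sym (place-out out)) e)))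

  place≡inner : ∀ {c b x c′ b′ x′} → place c b x ≡ inner c′ b′ x′ → c ≡ c′ × b ≡ b′ × x ≡ x′
  place≡inner {x = x} e with either (adj H v x)
  ... | inj₁ vx = ⊥-elim (anchor≢inner (trans (≡-sym (place-nbr vx)) e))
  ... | inj₂ out = inner-inj (trans (≡-sym (place-out out)) e)

  place-inj : ∀ {c b} x y → place c b x ≡ place c b y → x ≡ y
  place-inj {c} x y e with either (adj H v y)
  ... | inj₂ out = proj₂ (proj₂ (place≡inner (trans e (place-out out))))
  ... | inj₁ vy with vx , eq ← place≡anchor (trans e (place-nbr vy)) =
    ix-inj (nbrs v) x vx y vy (pos-inj c eq)

  -- The edges of colour `b`. The choice `c` is quantified because copies with different choices may
  -- share anchors.
  Joined : Bool → Fin size → Fin size → Set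
  Joined b p q = ∃[ c ] ∃[ x ] ∃[ y ]
    (x ≢ v × y ≢ v × Edge H x y × place c b x ≡ p × place c b y ≡ q)

  opaque
    joined? : ∀ b p q → Dec (Joined b p q)
    joined? b p q = search-Choice d m λ c → any? λ x → any? λ y →
      ¬? (x ≟ v) ×-dec ¬? (y ≟ v) ×-dec edge? H x y ×-dec (place c b x ≟ p) ×-dec (place c b y ≟ q)

  joined-sym : ∀ {b p q} → Joined b p q → Joined b q p
  joined-sym (c , x , y , x≢v , y≢v , xy , px , qy) =
    c , y , x , y≢v , x≢v , trans (sym H y x) xy , qy , px

  joined-irrefl : ∀ {b p} → ¬ Joined b p p
  joined-irrefl (c , x , y , _ , _ , xy , px , py)
    with refl ← place-inj x y (trans px (≡-sym py)) = true≢false xy (irrefl H x)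

  -- Independence of `N(v)` excludes edges between two neighbours of `v`. Hence every edge of the
  -- gadget has an inner end, which determines the glued copy it comes from.
  out-end : ∀ {x y} → Edge H x y → adj H v x ≡ false ⊎ adj H v y ≡ false
  out-end {x} {y} xy with either (adj H v x) | either (adj H v y)
  ... | inj₂ out | _        = inj₁ out
  ... | inj₁ _   | inj₂ out = inj₂ out
  ... | inj₁ vx  | inj₁ vy  = contradiction (indep _ _ vx vy) (true≢false xy)

  -- The inner end of the edge fixes the copy and with it the colour, so the two colour classes are
  -- disjoint.
  joined-colour : ∀ {b b′ p q} → Joined b p q → Joined b′ p q → b ≡ b′
  joined-colour (c , x , y , _ , _ , xy , px , qy) (c′ , x′ , y′ , _ , _ , _ , px′ , qy′)
    with out-end xy
  ... | inj₁ out = ≡-sym (proj₁ (proj₂ (place≡inner (trans px′ (trans (≡-sym px) (place-out out))))))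
  ... | inj₂ out = ≡-sym (proj₁ (proj₂ (place≡inner (trans qy′ (trans (≡-sym qy) (place-out out))))))

  opaque
    linked? : ∀ p q → Dec (∃[ b ] Joined b p q)
    linked? p q = search-Bool λ b → joined? b p q

  does-sym : ∀ {A B : Set} (a? : Dec A) (b? : Dec B) → (A → B) → (B → A) → does a? ≡ does b?
  does-sym a? b? f g = does-⇔ (mk⇔ f g) a? b?

  G : Graph
  G = record
    { n      = size
    ; adj    = λ p q → does (linked? p q)
    ; sym    = λ p q → does-sym (linked? p q) (linked? q p)
                 (λ (b , j) → b , joined-sym j) (λ (b , j) → b , joined-sym j)
    ; irrefl = λ p → dec-false (linked? p p) (λ (_ , j) → joined-irrefl j)
    }

  ψ : Colouring G
  ψ = record
    { col  = λ p q → does (joined? true p q)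
    ; csym = λ p q → does-sym (joined? true p q) (joined? true q p) joined-sym joined-sym
    }

  joined⇒edge : ∀ {b p q} → Joined b p q → Edge G p q
  joined⇒edge {p = p} {q} j = dec-true (linked? p q) (_ , j)

  ψ-joined : ∀ b {p q} → Joined b p q → col ψ p q ≡ b
  ψ-joined true  {p} {q} j = dec-true (joined? true p q) j
  ψ-joined false {p} {q} j = dec-false (joined? true p q) λ j′ → contradiction (joined-colour j′ j) λ ()

  edge⇒joined : ∀ {p q} → Edge G p q → Joined (col ψ p q) p q
  edge⇒joined {p} {q} pq with b , j ← does-sound (linked? p q) pq | joined? true p q
  ... | yes j′ = j′
  ... | no ¬red with b
  ... | true  = contradiction j ¬red
  ... | false = j

  -- Absence of monochromatic copies in the gadget

  module Copy (conn : ConnectedOn H (Outside H v)) (β : Bool) (e : Embedding H G)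
              (joined : ∀ x y → Edge H x y → Joined β (emb e x) (emb e y)) where

    Placed : Fin h → Set
    Placed a = ∃[ c ] ∃[ x ] (x ≢ v × place c β x ≡ emb e a)

    -- As `d` is positive, every `a` lies on an edge of `H`, and the image of that edge comes from
    -- some glued copy.
    placed : ∀ a → Placed a
    placed a with b , ab ← nbr a
      with c , x , _ , x≢v , _ , _ , eq , _ ← joined a b ab = c , x , x≢v , eq

    -- With a single choice, the whole copy lies in one glued `H − v`; reading off origins would
    -- inject the vertices of `H` into those other than `v`.
    collapse : ¬ (∀ (c c′ : Choice d m) → c ≡ c′)
    collapse unique = injective-missing (origin ∘ placed) (agree (placed _) (placed _)) v
                        (λ a → proj₁ (proj₂ (proj₂ (placed a))))
      where
      origin : ∀ {a} → Placed a → Fin h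
      origin (_ , x , _) = x

      agree : ∀ {a b} (p : Placed a) (q : Placed b) → origin p ≡ origin q → a ≡ b
      agree (c , x , _ , p) (c′ , _ , _ , q) refl with refl ← unique c c′ = inj e (trans (≡-sym p) q)

    start : ∃[ c ] ∃[ x ] ∃[ a ] (Outside H v x × emb e a ≡ inner c β x)
    start with u , vu ← nbr v
      with c , x , y , x≢v , y≢v , xy , px , qy ← joined v u vu
      with out-end xy
    ... | inj₁ out = c , x , v , (x≢v , out) , trans (≡-sym px) (place-out out)
    ... | inj₂ out = c , y , u , (y≢v , out) , trans (≡-sym qy) (place-out out)

    module _ (c : Choice d m) where

      Covered : Fin h → Set
      Covered y = ∃[ a ] emb e a ≡ place c β y

      module _ {a x : Fin h} (eq : emb e a ≡ inner c β x) where

        -- An inner vertex belongs to one glued copy only, so its neighbours lie there too.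
        local : ∀ b → Edge H a b → ∃[ y ] (Edge H x y × place c β y ≡ emb e b)
        local b ab with c′ , x′ , y , _ , _ , xy , px , qy ← joined a b ab
          with refl , _ , refl ← place≡inner (trans px eq) = y , xy , qy

        local-↪ : adj H a ↪ adj H x
        local-↪ = record
          { to     = λ b ab → proj₁ (local b ab)
          ; to-∈   = λ b ab → proj₁ (proj₂ (local b ab))
          ; to-inj = λ b ab b′ ab′ q → inj e (trans (≡-sym (proj₂ (proj₂ (local b ab))))
                       (trans (cong (place c β) q) (proj₂ (proj₂ (local b′ ab′)))))
          }

        -- Both neighbourhoods have size `d`, so the injection `local-↪` is onto.
        closed : ∀ y → Edge H x y → Covered y
        closed y xy with b , ab , refl ← ↪-onto (nbrs a) (nbrs x) local-↪ y xy =
          b , ≡-sym (proj₂ (proj₂ (local b ab)))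

      -- Vertices on the path are neither `v` nor neighbours of `v`, hence are placed at inner
      -- vertices, and `closed` applies at each step.
      spread : ∀ {x y} → Reach H (Outside H v) x y → Covered x → Covered y
      spread (here _) cov = cov
      spread (step (_ , out) xz path) (a , eq) =
        spread path (closed (trans eq (place-out out)) _ xz)

      -- The vertices that the copy of `H` has outside the glued `H − v` with index `(c, β)`.
      Stray : Fin h → Set
      Stray a = ∀ y → y ≢ v → emb e a ≢ place c β y

      stray? : ∀ a → Dec (Stray a)
      stray? a = all? λ y → ¬? (y ≟ v) →-dec ¬? (emb e a ≟ place c β y)

      ¬stray⇒placed : ∀ a → ¬ Stray a → ∃[ y ] (y ≢ v × emb e a ≡ place c β y)
      ¬stray⇒placed a ¬s = decidable-stable
        (any? λ y → ¬? (y ≟ v) ×-dec (emb e a ≟ place c β y))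
        (λ none → ¬s λ y y≢v eq → none (y , y≢v , eq))

      module _ (covered : ∀ y → y ≢ v → Covered y) where

        -- Sending `v` to `z` and every other vertex to the one covering it is an injection of a
        -- finite set into itself, so no second stray vertex can be missed.
        stray-unique : ∀ z z′ → Stray z → Stray z′ → z ≡ z′
        stray-unique z z′ s s′ =
          decidable-stable (z ≟ z′) λ z≢z′ → injective-missing f f-inj z′ (misses z≢z′)
          where
          f : Fin h → Fin h
          f y with y ≟ v
          ... | yes _  = z
          ... | no y≢v = proj₁ (covered y y≢v)

          f-inj : Injective _≡_ _≡_ f
          f-inj {x} {y} eq with x ≟ v | y ≟ v
          ... | yes refl | yes refl = refl
          ... | yes _    | no y≢v   =
            ⊥-elim (s y y≢v (trans (cong (emb e) eq) (proj₂ (covered y y≢v))))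
          ... | no x≢v   | yes _    =
            ⊥-elim (s x x≢v (trans (cong (emb e) (≡-sym eq)) (proj₂ (covered x x≢v))))
          ... | no x≢v   | no y≢v   =
            place-inj x y (trans (≡-sym (proj₂ (covered x x≢v)))
                          (trans (cong (emb e) eq) (proj₂ (covered y y≢v))))

          misses : z ≢ z′ → ∀ y → f y ≢ z′
          misses z≢z′ y eq with y ≟ v
          ... | yes _  = z≢z′ eq
          ... | no y≢v = s′ y y≢v (trans (cong (emb e) (≡-sym eq)) (proj₂ (covered y y≢v)))

        -- An edge at an anchor ends at an inner vertex of some glued copy whose choice contains
        -- that anchor.
        leave : ∀ {u a b} → (vu : Edge H v u) → emb e a ≡ place c β u → Edge H a b →
                ∃[ c′ ] ∃[ x ] ∃[ y ] Σ (Edge H v x) λ vx →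
                  pos c′ (ix (nbrs v) x vx) ≡ pos c (ix (nbrs v) u vu) ×
                  y ≢ v × adj H v y ≡ false × Edge H x y × emb e b ≡ inner c′ β y
        leave {u} {a} {b} vu eq ab with c′ , x , y , _ , y≢v , xy , px , qy ← joined a b ab
          with vx , same ← place≡anchor (trans px (trans eq (place-nbr vu)))
          with out-end xy
        ... | inj₁ out = contradiction out (true≢false vx)
        ... | inj₂ out = c′ , x , y , vx , same , y≢v , out , xy , trans (≡-sym qy) (place-out out)

        -- Otherwise the `d` neighbours of `a` would inject into the neighbours of `u` other than
        -- `v`, of which there are only `d − 1`.
        stray-nbr : ∀ u → Edge H v u → ∀ a → emb e a ≡ place c β u → ∃[ z ] (Edge H a z × Stray z)
        stray-nbr u vu a eq = decidable-stable (any? λ z → edge? H a z ×-dec stray? z) λ none →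
          let
            local : ∀ b → Edge H a b → ∃[ y ] (y ≢ v × Edge H u y × emb e b ≡ place c β y)
            local b ab = locate b ab (¬stray⇒placed b λ s → none (b , ab , s))
          in ℕ.<-irrefl refl (↪-missing⇒< (nbrs a) (nbrs u) (f local) v (trans (sym H u v) vu)
               (λ b ab → proj₁ (proj₂ (local b ab))))
          where
          -- By `leave`, `b` is inner, which forces `c′` to be `c`; the shared anchor then forces
          -- `x` to be `u`.
          locate : ∀ b → Edge H a b → ∃[ y ] (y ≢ v × emb e b ≡ place c β y) →
                   ∃[ y ] (y ≢ v × Edge H u y × emb e b ≡ place c β y)
          locate b ab (y , y≢v , at-y)
            with c′ , x , y′ , vx , same , _ , _ , xy , at-y′ ← leave vu eq ab
            with refl , _ , refl ← place≡inner (trans (≡-sym at-y) at-y′)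
            with refl ← ix-inj (nbrs v) x vx u vu (pos-inj c same)
            = y , y≢v , xy , at-y

          f : (∀ b → Edge H a b → ∃[ y ] (y ≢ v × Edge H u y × emb e b ≡ place c β y)) →
              adj H a ↪ adj H u
          f local = record
            { to     = λ b ab → proj₁ (local b ab)
            ; to-∈   = λ b ab → proj₁ (proj₂ (proj₂ (local b ab)))
            ; to-inj = λ b ab b′ ab′ q → inj e (trans (proj₂ (proj₂ (proj₂ (local b ab))))
                         (trans (cong (place c β) q) (≡-sym (proj₂ (proj₂ (proj₂ (local b′ ab′)))))))
            }

        nbr≢v : ∀ {u} → Edge H v u → u ≢ v
        nbr≢v vu refl = true≢false vu (irrefl H v)

        -- Every anchor of `c` has a stray neighbour, and by uniqueness this is always `z`.
        stray-cell : ∀ z → Stray z → ∀ u (vu : Edge H v u) → ∃[ c′ ] ∃[ y ]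
          (y ≢ v × adj H v y ≡ false × emb e z ≡ inner c′ β y ×
           ∃[ j ] pos c′ j ≡ pos c (ix (nbrs v) u vu))
        stray-cell z s u vu =
          let a , eq = covered u (nbr≢v vu)
              z′ , az′ , s′ = stray-nbr u vu a eq
              c′ , _ , y , _ , same , y≢v , out , _ , at-y = leave vu eq az′
          in c′ , y , y≢v , out , trans (cong (emb e) (stray-unique z z′ s s′)) at-y , _ , same

        -- The inner vertex at `z` lies in only one glued copy, so the choice of that copy contains
        -- all anchors of `c` and equals it.
        same-choice : ∀ z → Stray z → ∀ c₁ y → emb e z ≡ inner c₁ β y → c ≡ c₁
        same-choice z s c₁ y at-y = pos-antichain c c₁ sub
          where
          sub : ∀ i → ∃[ j ] pos c₁ j ≡ pos c i
          sub i =
            let c′ , _ , _ , _ , at-y′ , j , same = stray-cell z s (at (nbrs v) i) (at-∈ (nbrs v) i)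
                c₁≡c′ = proj₁ (inner-inj (trans (≡-sym at-y) at-y′))
            in j , trans (cong (λ c → pos c j) c₁≡c′) (trans same (cong (pos c) (ix-at (nbrs v) i _)))

        absurd : ⊥
        absurd =
          let u , vu = nbr v
              a , eq = covered u (nbr≢v vu)
              z , _ , s = stray-nbr u vu a eq
              c₁ , y , y≢v , out , at-y , _ = stray-cell z s u vu
              c₁≡c = ≡-sym (same-choice z s c₁ y at-y)
          in s y y≢v (trans at-y (trans (cong (λ c → inner c β y) c₁≡c) (≡-sym (place-out out))))

    other-member : ∀ {k} {p : Fin h → Bool} → 2 ≤ k → Enumeration p k → ∃[ y ] (y ≢ v × p y ≡ true)
    other-member (s≤s (s≤s _)) E with at E zero ≟ v
    ... | no ≢v  = at E zero , ≢v , at-∈ E zero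
    ... | yes ≡v = at E (suc zero)
                 , (λ eq → contradiction (at-inj E (trans ≡v (≡-sym eq))) λ ())
                 , at-∈ E (suc zero)

    -- A neighbour of `u` other than `v` exists as `d` is at least 2, and independence keeps it out
    -- of `N(v)`.
    outside-nbr : 2 ≤ d → ∀ u → Edge H v u → ∃[ y ] (Edge H u y × Outside H v y)
    outside-nbr le u vu with y , y≢v , uy ← other-member le (nbrs u) =
      y , uy , y≢v , Bool.¬-not (λ vy → contradiction (indep u y vu vy) (true≢false uy))

    impossible : 2 ≤ d ⊎ (∀ (c c′ : Choice d m) → c ≡ c′) → ⊥
    impossible (inj₂ unique) = collapse unique
    impossible (inj₁ 2≤d) with c , x , a , out , eq ← start = absurd c covered
      where
      outside : ∀ y → Outside H v y → Covered c y
      outside y o = spread c (conn x y out o) (a , trans eq (≡-sym (place-out (proj₂ out))))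

      -- Vertices outside `N(v)` are reached by connectivity, and a neighbour of `v` through a
      -- neighbour of its own outside `N(v)`.
      covered : ∀ y → y ≢ v → Covered c y
      covered y y≢v with either (adj H v y)
      ... | inj₂ out = outside y (y≢v , out)
      ... | inj₁ vy with z , yz , o ← outside-nbr 2≤d y vy
        with b , at-z ← outside z o =
        closed c (trans at-z (place-out (proj₂ o))) y (trans (sym H z y) yz)

  ψ-good : ConnectedOn H (Outside H v) →
           2 ≤ d ⊎ (∀ (c c′ : Choice d m) → c ≡ c′) → ¬ MonoCopy G ψ H
  ψ-good conn large (β , e , mono) = Copy.impossible conn β e joined large
    where
    joined : ∀ x y → Edge H x y → Joined β (emb e x) (emb e y)
    joined x y xy =
      subst (λ b → Joined b (emb e x) (emb e y)) (mono x y xy) (edge⇒joined (edges e x y xy))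

-- Joining a new vertex to part of a graph

addVertex : (F : Graph) → (Fin (n F) → Bool) → Graph
addVertex F p = record
  { n      = suc (n F)
  ; adj    = λ { zero zero → false ; zero (suc y) → p y
               ; (suc x) zero → p x ; (suc x) (suc y) → adj F x y }
  ; sym    = λ { zero zero → refl ; zero (suc _) → refl
               ; (suc _) zero → refl ; (suc x) (suc y) → sym F x y }
  ; irrefl = λ { zero → refl ; (suc x) → irrefl F x }
  }

addVertex-deletion : ∀ F p → Deletion (addVertex F p) zero F
addVertex-deletion F p = record
  { ι      = record { imap = suc ; iinj = suc-injective ; iadj = λ _ _ → refl }
  ; avoids = λ _ ()
  ; covers = λ { zero ≢0 → contradiction refl ≢0 ; (suc y) _ → y , refl }
  }

image : ∀ {k N} → (Fin k → Fin N) → Fin N → Bool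
image f y = does (any? λ i → f i ≟ y)

image-∈ : ∀ {k N} (f : Fin k → Fin N) i → image f (f i) ≡ true
image-∈ f i = dec-true (any? λ j → f j ≟ f i) (i , refl)

count-image : ∀ {k N} (f : Fin k → Fin N) → count (image f) ≤ k
count-image {k} f = ↪⇒≤ (enumerate (image f)) (subst (Enumeration _) (count-all k) (enumerate _)) record
  { to     = λ y py → proj₁ (origin y py)
  ; to-∈   = λ _ _ → refl
  ; to-inj = λ y py z pz eq →
      trans (≡-sym (proj₂ (origin y py))) (trans (cong f eq) (proj₂ (origin z pz)))
  }
  where
  origin : ∀ y → image f y ≡ true → ∃[ i ] f i ≡ y
  origin y = does-sound (any? λ i → f i ≟ y)

-- With fewer than `d` values `true` among `2d − 1`, at least `d` are `false`.
majority : ∀ d (χ : Fin (2 * d ∸ 1) → Bool) → ∃[ β ] d ≤ count (is β ∘ χ)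
majority d χ with d ≤? count χ
... | yes le = true , le
... | no lt = false , ℕ.+-cancelˡ-≤ (count χ) _ _ (begin
  count χ + d                ≤⟨ ℕ.<⇒≤pred (ℕ.+-monoˡ-< d (ℕ.≰⇒> lt)) ⟩
  d + d ∸ 1                  ≡⟨ cong (λ k → d + k ∸ 1) (ℕ.+-identityʳ d) ⟨
  2 * d ∸ 1                  ≡⟨ count-complement χ ⟨
  count χ + count (not ∘ χ)  ∎)
  where open ℕ.≤-Reasoning

-- The arrowing graph with an apex of degree at most 2d - 1

module Construction (d₀ : ℕ) (H : Graph) (reg : Regular (suc d₀) H) (bel : HasBEL H)
                    (v : Fin (n H)) (indep : NbhdIndependent H v)
                    (conn : ConnectedOn H (Outside H v)) where

  m : ℕ
  m = 2 * suc d₀ ∸ 1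

  open Gadget d₀ m H reg v indep

  large : 2 ≤ d ⊎ (∀ (c c′ : Choice d m) → c ≡ c′)
  large = go d₀
    where
    go : ∀ k → 2 ≤ suc k ⊎ (∀ (c c′ : Choice (suc k) (2 * suc k ∸ 1)) → c ≡ c′)
    -- For degree 1 there is one anchor, hence one choice.
    go zero    = inj₂ λ { (take done) (take done) → refl }
    go (suc k) = inj₁ (s≤s (s≤s z≤n))

  private
    gadget = bel G ψ (ψ-good conn large)

  F₀ : Graph
  F₀ = proj₁ gadget

  F₀-fails : ¬ Arrows F₀ H
  F₀-fails = proj₁ (proj₂ gadget)

  ι₀ : InducedEmbedding G F₀
  ι₀ = proj₁ (proj₂ (proj₂ gadget))

  rigid : ∀ φ → ¬ MonoCopy F₀ φ H →
    (∀ p q → Edge G p q → col φ (imap ι₀ p) (imap ι₀ q) ≡ col ψ p q)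
    ⊎ (∀ p q → Edge G p q → col φ (imap ι₀ p) (imap ι₀ q) ≡ not (col ψ p q))
  rigid = proj₂ (proj₂ (proj₂ gadget))

  F : Graph
  F = addVertex F₀ (image (imap ι₀ ∘ anchor))

  D₀ : Deletion F zero F₀
  D₀ = addVertex-deletion F₀ _

  apex-degree : deg F zero ≤ m
  apex-degree = ℕ.≤-trans (ℕ.≤-reflexive (deg≡count F zero)) (count-image (imap ι₀ ∘ anchor))

  -- The BEL property leaves open which way round the colours are. Since the gadget has copies in
  -- both colours, one of its colour classes receives `b` in either case.
  rigid-block : ∀ φ → ¬ MonoCopy F₀ φ H → ∀ b →
    ∃[ β ] (∀ p q → Joined β p q → col φ (imap ι₀ p) (imap ι₀ q) ≡ b)
  rigid-block φ good b with rigid φ good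
  ... | inj₁ same = b , λ p q j → trans (same p q (joined⇒edge j)) (ψ-joined b j)
  ... | inj₂ flip = not b , λ p q j → trans (flip p q (joined⇒edge j))
          (trans (cong not (ψ-joined (not b) j)) (Bool.not-involutive b))

  module _ (c : Choice d m) (β : Bool) where

    target : Fin h → Fin (n F)
    target x with x ≟ v
    ... | yes _ = zero
    ... | no _  = suc (imap ι₀ (place c β x))

    target-inj : Injective _≡_ _≡_ target
    target-inj {x} {y} eq with x ≟ v | y ≟ v
    ... | yes refl | yes refl = refl
    ... | no _     | no _     = place-inj x y (iinj ι₀ (suc-injective eq))

    joined-place : ∀ {x y} → x ≢ v → y ≢ v → Edge H x y → Joined β (place c β x) (place c β y)
    joined-place x≢v y≢v xy = c , _ , _ , x≢v , y≢v , xy , refl , refl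

    apex-edge : ∀ {y} → Edge H v y → image (imap ι₀ ∘ anchor) (imap ι₀ (place c β y)) ≡ true
    apex-edge vy rewrite place-nbr {c} {β} vy = image-∈ (imap ι₀ ∘ anchor) _

    target-edges : ∀ x y → Edge H x y → Edge F (target x) (target y)
    target-edges x y xy with x ≟ v | y ≟ v
    ... | yes refl | yes refl = contradiction (irrefl H v) (true≢false xy)
    ... | yes refl | no _     = apex-edge xy
    ... | no _     | yes refl = apex-edge (trans (sym H v x) xy)
    ... | no x≢v   | no y≢v   = trans (iadj ι₀ _ _) (joined⇒edge (joined-place x≢v y≢v xy))

    copy : Embedding H F
    copy = record { emb = target ; inj = target-inj ; edges = target-edges }

    module _ (φ : Colouring F) (b : Bool)
             (star : ∀ i → col φ zero (suc (imap ι₀ (anchor (pos c i)))) ≡ b)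
             (block : ∀ p q → Joined β p q → col φ (suc (imap ι₀ p)) (suc (imap ι₀ q)) ≡ b) where

      spoke : ∀ {y} → Edge H v y → col φ zero (suc (imap ι₀ (place c β y))) ≡ b
      spoke vy rewrite place-nbr {c} {β} vy = star _

      copy-mono : ∀ x y → Edge H x y → col φ (target x) (target y) ≡ b
      copy-mono x y xy with x ≟ v | y ≟ v
      ... | yes refl | yes refl = contradiction (irrefl H v) (true≢false xy)
      ... | yes refl | no _     = spoke xy
      ... | no _     | yes refl = trans (csym φ _ _) (spoke (trans (sym H v x) xy))
      ... | no x≢v   | no y≢v   = block _ _ (joined-place x≢v y≢v xy)

  F-arrows : Arrows F H
  F-arrows φ with monoCopy? F₀ (pullback (inclusion D₀) φ) H
  ... | yes found = push (inclusion D₀) φ found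
  ... | no good =
    -- `b` is a majority colour at the apex, `c` selects `d` anchors joined to it in that colour,
    -- and `β` is the gadget class that `φ` colours `b`.
    let b , le    = majority d (λ s → col φ zero (suc (imap ι₀ (anchor s))))
        c , star  = choose _ le
        β , block = rigid-block (pullback (inclusion D₀) φ) good b
    in b , copy c β , copy-mono c β φ b (λ i → is-sound b (star i)) block

theorem4p2 : ∀ (d : ℕ) (H : Graph) → 1 ≤ d → Regular d H → HasBEL H →
    (∃[ v ] (NbhdIndependent H v × ConnectedOn H (Outside H v))) →
    SEq H (2 * d ∸ 1)
theorem4p2 (suc d₀) H _ reg bel (v , indep , conn) =
  minimal-degree-attained D₀ F-arrows F₀-fails apex-degree lower , lower
  where
  open Construction d₀ H reg bel v indep conn
  lower : ∀ F → RamseyMinimal F H → ∀ x → m ≤ deg F x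
  lower F = minimal-degree (s≤s z≤n) reg
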